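{- Let $n\ge 5$ be even and let $x,y$ be adjacent vertices of $Q_n$ with $f_n(x)+f_n(y)=\operatorname{str}_{f_n}(Q_n)$. If $x$ and $y$ both begin with $11$, then $$\operatorname{str}_{f_n}(Q_n)\le \operatorname{str}_{f_{n-2}}(Q_{n-2})+3\cdot 2^{n-2}+\binom{n-3}{\lceil (n-3)/2\rceil}+\binom{n-2}{\lceil (n-2)/2\rceil}.$$
   Context: $Q_n$ is the $n$-dimensional hypercube: vertices are the $n$-bit strings, adjacent iff they differ in exactly one position. For a bijection $f:V(G)\to\{1,\dots,|V(G)|\}$, $\operatorname{str}_f(G)=\max\{f(u)+f(v):uv\in E(G)\}$. An $n$-bit string is $x_1\cdots x_n$, $x_i\in\{0,1\}$; its weight is its number of $1$s. Lexicographic order: $x<y$ if for some $k$, $x_j=y_j$ for $j<k$ and $x_k<y_k$. $S_n^i$ is the sequence of $n$-bit strings of weight $i$ in increasing lexicographic order; $R_n^i$ is the same set in decreasing lexicographic order. $S_n$ is the concatenation $(R_n^1,R_n^3,\dots,R_n^{n-1},S_n^n,S_n^{n-2},\dots,S_n^2,S_n^0)$ for even $n$ and $(R_n^1,R_n^3,\dots,R_n^{n-2},R_n^n,S_n^{n-1},\dots,S_n^2,S_n^0)$ for odd $n$; $f_n$ maps the string in position $j$ of $S_n$ to $j$. -}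

module Defs where

open import Data.Bool using (Bool; true; false)
import Data.Bool as Bool
import Data.Bool.Properties as Bool
open import Data.Fin using (zero; suc; toℕ; fromℕ<)
import Data.Fin.Properties as Fin
open import Data.List using (List; []; _∷_; _++_; map; filter; reverse; concatMap; cartesianProduct; upTo; downFrom; length)
import Data.List as List
open import Data.List.Extrema.Nat using (max)
open import Data.List.Membership.Propositional using (_∈_; lose; find)
open import Data.List.Membership.Propositional.Properties using (∈-map⁺; ∈-++⁺ˡ; ∈-++⁺ʳ; ∈-filter⁺; ∈-filter⁻; ∈-concatMap⁺; ∈-concatMap⁻; ∈-upTo⁺; ∈-downFrom⁺; ∈-lookup)
open import Data.List.Membership.Propositional.Properties.WithK using (unique⇒irrelevant; unique∧set⇒bag)
open import Data.List.Properties using (length-++; length-map; unfold-reverse)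
open import Data.List.Relation.Binary.BagAndSetEquality using (∼bag⇒↭)
open import Data.List.Relation.Binary.Disjoint.Propositional using (Disjoint)
open import Data.List.Relation.Binary.Permutation.Propositional.Properties using (↭-length)
open import Data.List.Relation.Binary.Prefix.Heterogeneous using (Prefix)
open import Data.List.Relation.Unary.All as All using ()
import Data.List.Relation.Unary.All.Properties as All
open import Data.List.Relation.Unary.AllPairs as AllPairs using (AllPairs; []; _∷_)
import Data.List.Relation.Unary.AllPairs.Properties as AllPairs
open import Data.List.Relation.Unary.Any using (here; index)
import Data.List.Relation.Unary.Any.Properties as Any
open import Data.List.Relation.Unary.Unique.Propositional using (Unique)
import Data.List.Relation.Unary.Unique.Propositional.Properties as Unique
open import Data.Nat using (ℕ; zero; suc; _+_; _^_; _≤_; _<_; _≟_; z≤n; s≤s)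
open import Data.Nat.Divisibility using (_∣?_)
open import Data.Nat.Properties using (+-identityʳ; suc-injective)
open import Data.Product using (_×_; _,_; proj₁; proj₂; ∃)
open import Data.Vec using (Vec; []; _∷_; zip; count; toList)
open import Data.Vec.Properties using (count≤n)
open import Data.Vec.Relation.Binary.Lex.Strict using (Lex-<; this; next; <-irrefl)
import Data.Vec.Relation.Binary.Pointwise.Inductive as Pointwise
open import Function using (_⇔_; mk⇔; Equivalence; flip; _∘_)
open import Relation.Binary.PropositionalEquality using (_≡_; _≢_; refl; sym; trans; cong; cong₂; subst)
open import Relation.Nullary using (yes; no; ¬?)

private
  variable
    n : ℕ

Vertex : ℕ → Set
Vertex n = Vec Bool n

weight : Vertex n → ℕ
weight = count (Bool._≟ true)

hamming : Vertex n → Vertex n → ℕ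
hamming x y = count (λ (a , b) → ¬? (a Bool.≟ b)) (zip x y)

Adjacent : Vertex n → Vertex n → Set
Adjacent x y = hamming x y ≡ 1

infix 4 _<ₗ_

_<ₗ_ : Vertex n → Vertex n → Set
_<ₗ_ = Lex-< _≡_ Bool._<_

BeginsWith : List Bool → Vertex n → Set
BeginsWith w x = Prefix _≡_ w (toList x)

-- Every vertex once, in increasing lexicographic order (vertices-sorted,
-- ∈-vertices).
vertices : ∀ n → List (Vertex n)
vertices zero    = [] ∷ []
vertices (suc n) = map (false ∷_) (vertices n) ++ map (true ∷_) (vertices n)

-- Each edge uv occurs both as (u , v) and as (v , u).
edges : ∀ n → List (Vertex n × Vertex n)
edges n = filter (λ (u , v) → hamming u v ≟ 1) (cartesianProduct (vertices n) (vertices n))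

-- The base value 0 is returned only when there are no edges, i.e. for n = 0.
str : (Vertex n → ℕ) → ℕ
str {n} f = max 0 (map (λ (u , v) → f u + f v) (edges n))

S : ∀ n → ℕ → List (Vertex n)
S n i = filter (λ x → weight x ≟ i) (vertices n)

R : ∀ n → ℕ → List (Vertex n)
R n i = reverse (S n i)

-- For either parity of n, S_n lists the odd weights ≤ n upwards (using R)
-- and then the even weights ≤ n downwards (using S).
oddWeights↑ : ℕ → List ℕ
oddWeights↑ n = filter (λ i → ¬? (2 ∣? i)) (upTo (suc n))

evenWeights↓ : ℕ → List ℕ
evenWeights↓ n = filter (2 ∣?_) (downFrom (suc n))

Sₙ : ∀ n → List (Vertex n)
Sₙ n = concatMap (R n) (oddWeights↑ n) ++ concatMap (S n) (evenWeights↓ n)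

∈-vertices : (x : Vertex n) → x ∈ vertices n
∈-vertices []          = here refl
∈-vertices (false ∷ x) = ∈-++⁺ˡ (∈-map⁺ _ (∈-vertices x))
∈-vertices {suc n} (true ∷ x) =
  ∈-++⁺ʳ (map (false ∷_) (vertices n)) (∈-map⁺ _ (∈-vertices x))

vertices-sorted : ∀ n → AllPairs _<ₗ_ (vertices n)
vertices-sorted zero    = All.[] ∷ []
vertices-sorted (suc n) = AllPairs.++⁺ (block false) (block true)
  (All.map⁺ (All.universal (λ _ → All.map⁺ (All.universal (λ _ → this Bool.f<t refl) _)) _))
  where
  block : ∀ b → AllPairs _<ₗ_ (map (b ∷_) (vertices n))
  block b = AllPairs.map⁺ (AllPairs.map (next refl) (vertices-sorted n))

length-vertices : ∀ n → length (vertices n) ≡ 2 ^ n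
length-vertices zero    = refl
length-vertices (suc n) = trans (length-++ (map (false ∷_) (vertices n)))
  (cong₂ _+_ (block false) (trans (block true) (sym (+-identityʳ _))))
  where
  block : ∀ b → length (map (b ∷_) (vertices n)) ≡ 2 ^ n
  block b = trans (length-map (b ∷_) (vertices n)) (length-vertices n)

∈-S : ∀ {i} {x : Vertex n} → x ∈ S n i ⇔ weight x ≡ i
∈-S {n} {i} {x} = mk⇔ (proj₂ ∘ ∈-filter⁻ (λ x → weight x ≟ i) {xs = vertices n})
                      (∈-filter⁺ (λ x → weight x ≟ i) (∈-vertices x))

∈-R : ∀ {i} {x : Vertex n} → x ∈ R n i ⇔ weight x ≡ i
∈-R = mk⇔ (Equivalence.to ∈-S ∘ Any.reverse⁻) (Any.reverse⁺ ∘ Equivalence.from ∈-S)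

S-increasing : ∀ n i → AllPairs _<ₗ_ (S n i)
S-increasing n i = AllPairs.filter⁺ (λ x → weight x ≟ i) (vertices-sorted n)

R-decreasing : ∀ n i → AllPairs (flip _<ₗ_) (R n i)
R-decreasing n i = reverse⁺ (S-increasing n i)
  where
  reverse⁺ : ∀ {xs : List (Vertex n)} → AllPairs _<ₗ_ xs → AllPairs (flip _<ₗ_) (reverse xs)
  reverse⁺ [] = []
  reverse⁺ {x ∷ xs} (x< ∷ xs<) rewrite unfold-reverse x xs =
    AllPairs.++⁺ (reverse⁺ xs<) (All.[] ∷ [])
      (All.tabulate (λ y∈ → All.lookup x< (Any.reverse⁻ y∈) All.∷ All.[]))

∈-Sₙ : (x : Vertex n) → x ∈ Sₙ n
∈-Sₙ {n} x with 2 ∣? weight x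
... | no odd = ∈-++⁺ˡ (∈-concatMap⁺ (R n)
        (lose (∈-filter⁺ (λ i → ¬? (2 ∣? i)) (∈-upTo⁺ (s≤s (count≤n _ x))) odd) (Equivalence.from ∈-R refl)))
... | yes even = ∈-++⁺ʳ (concatMap (R n) (oddWeights↑ n)) (∈-concatMap⁺ (S n)
        (lose (∈-filter⁺ (2 ∣?_) (∈-downFrom⁺ (s≤s (count≤n _ x))) even) (Equivalence.from ∈-S refl)))

-- The 1-based position of x in S_n.  S_n has no repetitions (Sₙ-unique), so the
-- position does not depend on the membership proof used.
f : ∀ n → Vertex n → ℕ
f n x = suc (toℕ (index (∈-Sₙ x)))

<ₗ⇒≢ : {x y : Vertex n} → x <ₗ y → x ≢ y
<ₗ⇒≢ x<y refl = <-irrefl Bool.<-irrefl (Pointwise.refl refl) x<y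

Sₙ-unique : ∀ n → Unique (Sₙ n)
Sₙ-unique n = Unique.++⁺
  (blocks (R n) (Equivalence.to ∈-R) (λ i → AllPairs.map (λ y<x → <ₗ⇒≢ y<x ∘ sym) (R-decreasing n i))
    (Unique.filter⁺ (λ i → ¬? (2 ∣? i)) (Unique.upTo⁺ (suc n))))
  (blocks (S n) (Equivalence.to ∈-S) (λ i → AllPairs.map <ₗ⇒≢ (S-increasing n i))
    (Unique.filter⁺ (2 ∣?_) (Unique.downFrom⁺ (suc n))))
  disjoint
  where
  blocks : (T : ℕ → List (Vertex n)) → (∀ {i x} → x ∈ T i → weight x ≡ i) →
           (∀ i → Unique (T i)) → ∀ {is} → Unique is → Unique (concatMap T is)
  blocks T T-weight T-unique is! = Unique.concat⁺
    (All.map⁺ (All.universal T-unique _))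
    (AllPairs.map⁺ (AllPairs.map {S = λ i j → Disjoint (T i) (T j)}
      (λ i≢j (x∈ , x∈′) → i≢j (trans (sym (T-weight x∈)) (T-weight x∈′))) is!))

  disjoint : Disjoint (concatMap (R n) (oddWeights↑ n)) (concatMap (S n) (evenWeights↓ n))
  disjoint (x∈R , x∈S)
    with i , i∈ , x∈Ri ← find (∈-concatMap⁻ (R n) x∈R)
       | j , j∈ , x∈Sj ← find (∈-concatMap⁻ (S n) x∈S)
    with refl ← trans (sym (Equivalence.to ∈-R x∈Ri)) (Equivalence.to ∈-S x∈Sj)
    = proj₂ (∈-filter⁻ (λ i → ¬? (2 ∣? i)) {xs = upTo (suc n)} i∈)
            (proj₂ (∈-filter⁻ (2 ∣?_) {xs = downFrom (suc n)} j∈))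

length-Sₙ : ∀ n → length (Sₙ n) ≡ 2 ^ n
length-Sₙ n = trans
  (↭-length (∼bag⇒↭ (unique∧set⇒bag (Sₙ-unique n) (AllPairs.map <ₗ⇒≢ (vertices-sorted n))
    (λ {x} → mk⇔ (λ _ → ∈-vertices x) (λ _ → ∈-Sₙ x)))))
  (length-vertices n)

-- With f-injective and f-surjective: f n is a bijection onto {1,…,2ⁿ}.
f-bounds : (x : Vertex n) → 1 ≤ f n x × f n x ≤ 2 ^ n
f-bounds {n} x = s≤s z≤n , subst (f n x ≤_) (length-Sₙ n) (Fin.toℕ<n (index (∈-Sₙ x)))

f-injective : {x y : Vertex n} → f n x ≡ f n y → x ≡ y
f-injective {n} {x} {y} eq = trans (Any.lookup-index (∈-Sₙ x))
  (trans (cong (List.lookup (Sₙ n)) (Fin.toℕ-injective (suc-injective eq)))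
         (sym (Any.lookup-index (∈-Sₙ y))))

f-surjective : ∀ {j} → 1 ≤ j → j ≤ 2 ^ n → ∃ λ x → f n x ≡ j
f-surjective {n} {suc j} _ j<2ⁿ = List.lookup (Sₙ n) k , cong suc
  (trans (cong toℕ (trans (cong index (unique⇒irrelevant (Sₙ-unique n) _ (∈-lookup k)))
                          (index-∈-lookup (Sₙ n) k)))
         (Fin.toℕ-fromℕ< j<))
  where
  j< = subst (j <_) (sym (length-Sₙ n)) j<2ⁿ
  k = fromℕ< j<

  index-∈-lookup : ∀ (xs : List (Vertex n)) k → index (∈-lookup {xs = xs} k) ≡ k
  index-∈-lookup (x ∷ xs) zero    = refl
  index-∈-lookup (x ∷ xs) (suc k) = cong suc (index-∈-lookup xs k)

{-# OPTIONS --safe #-}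
module Submission where

-- Let z ◁ x mean that z and x have weights of the same parity and that z is
-- lighter than x, or equally heavy and lexicographically larger.  If x is odd,
-- the strings z ◁ x are those before x in S_n; if x is even, they are those
-- after x.  So with #◁ x = #{z : z ◁ x}, f_n(x) is 1 + #◁ x, respectively
-- 2ⁿ − #◁ x.  Splitting the strings by their first two bits gives
-- #◁(11u) = #◁ u + G(|u|) with G(i) = L(i+1) + 2 L(i), where L(j) is the number
-- of (n−3)-bit strings of weight < j.  For an edge between 11u (odd) and 11v
-- (even) the sum of labels thus grows by exactly 3·2ⁿ⁻² + G(|u|) − G(|v|), and
-- G(k+1) − G(k) = C(n−3,k) + C(n−2,k+1) is at most the two central coefficients.

open import Data.Bool using (true; false; if_then_else_)
import Data.Bool.Properties as Bool
open import Data.Fin using (toℕ)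
open import Data.List using (List; []; _∷_; _++_; map; length; upTo; downFrom; concatMap)
open import Data.List.Extrema.Nat using (v≤max⁺)
open import Data.List.Membership.Propositional using (_∈_; lose)
open import Data.List.Membership.Propositional.Properties using (∈-map⁺; ∈-filter⁺; ∈-cartesianProduct⁺)
open import Data.List.Membership.Propositional.Properties.WithK using (unique∧set⇒bag)
open import Data.List.Properties using (map-++; map-∘; map-cong)
open import Data.List.Relation.Binary.BagAndSetEquality using (∼bag⇒↭)
open import Data.List.Relation.Binary.Permutation.Propositional.Properties using (map⁺)
open import Data.List.Relation.Binary.Prefix.Heterogeneous as Prefix using ()
open import Data.List.Relation.Unary.All as All using (All; []; _∷_)
import Data.List.Relation.Unary.All.Properties as All
open import Data.List.Relation.Unary.AllPairs as AllPairs using (AllPairs; []; _∷_)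
import Data.List.Relation.Unary.AllPairs.Properties as AllPairs
open import Data.List.Relation.Unary.Any using (here; there; index)
open import Data.Nat using (ℕ; zero; suc; parity; _+_; _*_; _∸_; _^_; _≤_; _<_; _<?_; _≟_; ⌊_/2⌋; ⌈_/2⌉; z≤n; s≤s; s≤s⁻¹)
open import Data.Nat.Combinatorics using (_C_; nCk≡nC[n∸k]; k>n⇒nCk≡0; nCk+nC[k+1]≡[n+1]C[k+1])
open import Data.Nat.Divisibility using (_∣_; _∣?_; divides; ∣m∣n⇒∣m+n; ∣-refl; _∣0)
open import Data.Nat.ListAction using (sum)
open import Data.Nat.ListAction.Properties using (sum-++; sum-↭)
open import Data.Nat.Properties
open import Data.Nat.Tactic.RingSolver using (solve-∀)
open import Data.Parity using (Parity; 0ℙ; 1ℙ)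
open import Data.Parity.Properties as Parity using (suc-homo-⁻¹)
open import Data.Product using (_×_; _,_; proj₂)
open import Data.Sum using (_⊎_; inj₁; inj₂; [_,_]′; swap)
open import Data.Vec using ([]; _∷_)
open import Data.Vec.Relation.Binary.Lex.Strict using (this; next; <-decidable) renaming (<-asym to <ₗ-asym)
open import Function using (_∘_; flip; id; mk⇔; Equivalence)
open import Relation.Binary.PropositionalEquality
open import Relation.Nullary using (¬_; ¬?; Dec; yes; no; does; contradiction; _×-dec_; _⊎-dec_)
open import Defs

private
  variable
    n : ℕ
    A B P : Set

-- Binomial coefficients

-- Induction on the upper index. After Pascal's rule both sides share the term `n C suc k`, leaving
-- `n C k ≤ n C (2 + k)`: two steps of the induction if `2k + 2 < n`, and symmetry of the row if
-- `n = 2k + 2`.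
nCk≤nC[k+1] : ∀ n k → suc (k + k) ≤ n → n C k ≤ n C suc k
nCk≤nC[k+1] (suc n) zero    _ = subst (1 ≤_) (nCk+nC[k+1]≡[n+1]C[k+1] n 0) (s≤s z≤n)
nCk≤nC[k+1] (suc n) (suc k) 2k+2<1+n = begin
  suc n C suc k          ≡⟨ nCk+nC[k+1]≡[n+1]C[k+1] n k ⟨
  n C k + n C suc k      ≤⟨ +-monoˡ-≤ (n C suc k) nCk≤nC[k+2] ⟩
  n C (2 + k) + n C suc k ≡⟨ +-comm (n C (2 + k)) (n C suc k) ⟩
  n C suc k + n C (2 + k) ≡⟨ nCk+nC[k+1]≡[n+1]C[k+1] n (suc k) ⟩
  suc n C (2 + k)        ∎
  where
  open ≤-Reasoning
  2k+2≤n : 2 + (k + k) ≤ n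
  2k+2≤n = subst (_≤ n) (cong suc (+-suc k k)) (s≤s⁻¹ 2k+2<1+n)

  nCk≤nC[k+2] : n C k ≤ n C (2 + k)
  nCk≤nC[k+2] with m≤n⇒m<n∨m≡n 2k+2≤n
  ... | inj₁ 2k+2<n = ≤-trans (nCk≤nC[k+1] n k (<⇒≤ 2k+2≤n))
                              (nCk≤nC[k+1] n (suc k) (subst (_< n) (cong suc (sym (+-suc k k))) 2k+2<n))
  ... | inj₂ refl = ≤-reflexive (trans (nCk≡nC[n∸k] (m≤n+m k (2 + k)))
                                       (cong ((2 + (k + k)) C_) (m+n∸n≡m (2 + k) k)))

⌈n/2⌉+⌈n/2⌉≤1+n : ∀ n → ⌈ n /2⌉ + ⌈ n /2⌉ ≤ suc n
⌈n/2⌉+⌈n/2⌉≤1+n n = ≤-trans (+-monoʳ-≤ ⌈ n /2⌉ (⌈n/2⌉-mono (n≤1+n n)))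
  (≤-reflexive (⌊n/2⌋+⌈n/2⌉≡n (suc n)))

-- Climbs to the middle of the row one step at a time, by induction on the distance `d`. From
-- `suc k ≤ ⌈ n /2⌉` follows `2k + 1 ≤ n`, the condition for a step.
nC-mono-≤⌈n/2⌉ : ∀ n d k → d + k ≡ ⌈ n /2⌉ → n C k ≤ n C ⌈ n /2⌉
nC-mono-≤⌈n/2⌉ n zero    k refl = ≤-refl
nC-mono-≤⌈n/2⌉ n (suc d) k 1+d+k≡ = ≤-trans
  (nCk≤nC[k+1] n k (s≤s⁻¹ (subst (_≤ suc n) (cong suc (+-suc k k)) (≤-trans (+-mono-≤ 1+k≤ 1+k≤) (⌈n/2⌉+⌈n/2⌉≤1+n n)))))
  (nC-mono-≤⌈n/2⌉ n d (suc k) (trans (+-suc d k) 1+d+k≡))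
  where
  1+k≤ : suc k ≤ ⌈ n /2⌉
  1+k≤ = subst (suc k ≤_) 1+d+k≡ (s≤s (m≤n+m k d))

-- Beyond the middle the coefficient vanishes if `k > n`; otherwise `k` is reflected to
-- `n ∸ k ≤ ⌊ n /2⌋`, where monotonicity applies.
nCk≤nC⌈n/2⌉ : ∀ n k → n C k ≤ n C ⌈ n /2⌉
nCk≤nC⌈n/2⌉ n k with ≤-<-connex k ⌈ n /2⌉ | ≤-<-connex k n
... | inj₁ k≤ | _         = nC-mono-≤⌈n/2⌉ n (⌈ n /2⌉ ∸ k) k (m∸n+n≡m k≤)
... | inj₂ _  | inj₂ n<k  = subst (_≤ n C ⌈ n /2⌉) (sym (k>n⇒nCk≡0 n<k)) z≤n
... | inj₂ k> | inj₁ k≤n  = subst (_≤ n C ⌈ n /2⌉) (sym (nCk≡nC[n∸k] k≤n))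
  (nC-mono-≤⌈n/2⌉ n (⌈ n /2⌉ ∸ (n ∸ k)) (n ∸ k) (m∸n+n≡m n∸k≤))
  where
  n∸k≤ : n ∸ k ≤ ⌈ n /2⌉
  n∸k≤ = ≤-trans
    (m≤n+o⇒m∸n≤o n k (subst (_≤ k + ⌊ n /2⌋) (trans (+-comm ⌈ n /2⌉ ⌊ n /2⌋) (⌊n/2⌋+⌈n/2⌉≡n n))
                            (+-monoˡ-≤ ⌊ n /2⌋ (<⇒≤ k>))))
    (⌊n/2⌋≤⌈n/2⌉ n)

-- Parity

parity[1+n]≢parity[n] : ∀ n → parity (suc n) ≢ parity n
parity[1+n]≢parity[n] n eq = Parity.p≢p⁻¹ (parity (suc n)) (trans eq (sym (suc-homo-⁻¹ n)))

parity-suc-cong : ∀ m n → parity m ≡ parity n → parity (suc m) ≡ parity (suc n)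
parity-suc-cong m n eq = Parity.⁻¹-injective (trans (suc-homo-⁻¹ m) (trans eq (sym (suc-homo-⁻¹ n))))

parity-suc-≢ : ∀ m n → parity (suc m) ≢ parity n → parity m ≡ parity n
parity-suc-≢ m n ≢ with parity (suc m) | parity n | suc-homo-⁻¹ m
... | 0ℙ | 0ℙ | _  = contradiction refl ≢
... | 0ℙ | 1ℙ | eq = sym eq
... | 1ℙ | 0ℙ | eq = sym eq
... | 1ℙ | 1ℙ | _  = contradiction refl ≢

-- The only number below `2 + n` that exceeds `n` is `suc n`, and it has the wrong parity.
parity≡⇒≤ : ∀ {m n} → parity m ≡ parity n → m < 2 + n → m ≤ n
parity≡⇒≤ {m} {n} eq m<2+n with m≤n⇒m<n∨m≡n (s≤s⁻¹ m<2+n)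
... | inj₁ m<1+n = s≤s⁻¹ m<1+n
... | inj₂ refl  = contradiction eq (parity[1+n]≢parity[n] n)

2∣⇒parity≡0 : ∀ n → 2 ∣ n → parity n ≡ 0ℙ
2∣⇒parity≡0 n (divides q refl) = go q
  where
  go : ∀ q → parity (q * 2) ≡ 0ℙ
  go zero    = refl
  go (suc q) = go q

2∤⇒parity≡1 : ∀ n → ¬ 2 ∣ n → parity n ≡ 1ℙ
2∤⇒parity≡1 zero          2∤ = contradiction (2 ∣0) 2∤
2∤⇒parity≡1 (suc zero)    2∤ = refl
2∤⇒parity≡1 (suc (suc n)) 2∤ = 2∤⇒parity≡1 n (2∤ ∘ ∣m∣n⇒∣m+n ∣-refl)

-- Indicators and sums over the cube

𝟙 : Dec P → ℕ
𝟙 P? = if does P? then 1 else 0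

𝟙-yes : (P? : Dec P) → P → 𝟙 P? ≡ 1
𝟙-yes (yes _) _ = refl
𝟙-yes (no ¬p) p = contradiction p ¬p

𝟙-no : (P? : Dec P) → ¬ P → 𝟙 P? ≡ 0
𝟙-no (yes p) ¬p = contradiction p ¬p
𝟙-no (no _)  _  = refl

𝟙-cong : (A? : Dec A) (B? : Dec B) → (A → B) → (B → A) → 𝟙 A? ≡ 𝟙 B?
𝟙-cong A? (yes b) _ g = 𝟙-yes A? (g b)
𝟙-cong A? (no ¬b) f _ = 𝟙-no A? (¬b ∘ f)

𝟙-⊎ : (A? : Dec A) (B? : Dec B) (P? : Dec P) →
      (A → P) → (B → P) → (P → A ⊎ B) → (A → ¬ B) → 𝟙 P? ≡ 𝟙 A? + 𝟙 B?
𝟙-⊎ (yes a) (yes b) _  _ _ _ ¬ab = contradiction b (¬ab a)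
𝟙-⊎ (yes a) (no _)  P? f _ _ _   = 𝟙-yes P? (f a)
𝟙-⊎ (no _)  (yes b) P? _ g _ _   = 𝟙-yes P? (g b)
𝟙-⊎ (no ¬a) (no ¬b) P? _ _ h _   = 𝟙-no P? (λ p → [ ¬a , ¬b ]′ (h p))

∑ : (Vertex n → ℕ) → ℕ
∑ {n} g = sum (map g (vertices n))

∑-cong : {g h : Vertex n → ℕ} → (∀ z → g z ≡ h z) → ∑ g ≡ ∑ h
∑-cong g≗h = cong sum (map-cong g≗h (vertices _))

∑-suc : (g : Vertex (suc n) → ℕ) → ∑ g ≡ ∑ (g ∘ (false ∷_)) + ∑ (g ∘ (true ∷_))
∑-suc {n} g = begin
  sum (map g (map (false ∷_) vs ++ map (true ∷_) vs))             ≡⟨ cong sum (map-++ g (map (false ∷_) vs) (map (true ∷_) vs)) ⟩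
  sum (map g (map (false ∷_) vs) ++ map g (map (true ∷_) vs))     ≡⟨ sum-++ (map g (map (false ∷_) vs)) _ ⟩
  sum (map g (map (false ∷_) vs)) + sum (map g (map (true ∷_) vs)) ≡⟨ cong₂ _+_ (cong sum (map-∘ vs)) (cong sum (map-∘ vs)) ⟨
  ∑ (g ∘ (false ∷_)) + ∑ (g ∘ (true ∷_))                          ∎
  where
  open ≡-Reasoning
  vs = vertices n

∑-+ : (g h : Vertex n → ℕ) → ∑ (λ z → g z + h z) ≡ ∑ g + ∑ h
∑-+ {n} g h = go (vertices n)
  where
  interchange : ∀ a b c d → a + b + (c + d) ≡ a + c + (b + d)
  interchange = solve-∀

  go : ∀ zs → sum (map (λ z → g z + h z) zs) ≡ sum (map g zs) + sum (map h zs)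
  go []       = refl
  go (z ∷ zs) = trans (cong (g z + h z +_) (go zs)) (interchange (g z) (h z) _ _)

-- Counting strings by weight

∑[weight≡k]≡nCk : ∀ n k → ∑ {n} (λ z → 𝟙 (weight z ≟ k)) ≡ n C k
∑[weight≡k]≡nCk zero    zero    = refl
∑[weight≡k]≡nCk zero    (suc k) = sym (k>n⇒nCk≡0 {0} {suc k} (s≤s z≤n))
∑[weight≡k]≡nCk (suc n) zero    = begin
  ∑ {suc n} (λ z → 𝟙 (weight z ≟ 0))                                      ≡⟨ ∑-suc {n} _ ⟩
  ∑ {n} (λ z → 𝟙 (weight z ≟ 0)) + ∑ {n} (λ z → 𝟙 (suc (weight z) ≟ 0)) ≡⟨ cong₂ _+_ (∑[weight≡k]≡nCk n 0) (all-zero (vertices n)) ⟩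
  1 ∎
  where
  open ≡-Reasoning
  all-zero : (zs : List (Vertex n)) → sum (map (λ z → 𝟙 (suc (weight z) ≟ 0)) zs) ≡ 0
  all-zero []       = refl
  all-zero (_ ∷ zs) = all-zero zs
-- Splitting on the first bit gives the two terms of Pascal's rule.
∑[weight≡k]≡nCk (suc n) (suc k) = begin
  ∑ {suc n} (λ z → 𝟙 (weight z ≟ suc k))
    ≡⟨ ∑-suc {n} _ ⟩
  ∑ {n} (λ z → 𝟙 (weight z ≟ suc k)) + ∑ {n} (λ z → 𝟙 (suc (weight z) ≟ suc k))
    ≡⟨ cong₂ _+_ (∑[weight≡k]≡nCk n (suc k)) (trans
         (∑-cong {n} (λ z → 𝟙-cong (suc (weight z) ≟ suc k) (weight z ≟ k) suc-injective (cong suc)))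
         (∑[weight≡k]≡nCk n k)) ⟩
  n C suc k + n C k
    ≡⟨ +-comm (n C suc k) (n C k) ⟩
  n C k + n C suc k
    ≡⟨ nCk+nC[k+1]≡[n+1]C[k+1] n k ⟩
  suc n C suc k ∎
  where open ≡-Reasoning

#[weight<_] : ℕ → ∀ n → ℕ
#[weight< j ] n = ∑ {n} (λ z → 𝟙 (weight z <? j))

#[weight<1+j] : ∀ n j → #[weight< suc j ] n ≡ #[weight< j ] n + n C j
#[weight<1+j] n j = begin
  ∑ {n} (λ z → 𝟙 (weight z <? suc j))
    ≡⟨ ∑-cong {n} (λ z → 𝟙-⊎ (weight z <? j) (weight z ≟ j) (weight z <? suc j)
         m<n⇒m<1+n (s≤s ∘ ≤-reflexive) (m≤n⇒m<n∨m≡n ∘ s≤s⁻¹) <⇒≢) ⟩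
  ∑ {n} (λ z → 𝟙 (weight z <? j) + 𝟙 (weight z ≟ j))     ≡⟨ ∑-+ {n} _ _ ⟩
  #[weight< j ] n + ∑ {n} (λ z → 𝟙 (weight z ≟ j))       ≡⟨ cong (#[weight< j ] n +_) (∑[weight≡k]≡nCk n j) ⟩
  #[weight< j ] n + n C j                                ∎
  where open ≡-Reasoning

-- Opposite parity is expressed by an equation with `suc w`. Since `parity (suc (suc n))` computes
-- to `parity n`, this is literally the parity condition for a string with prefix 01 or 10 against
-- one with prefix 11.
OppositeParity< : ℕ → ℕ → Set
OppositeParity< j w = parity (suc w) ≡ parity j × w < j

oppositeParity<? : ∀ j w → Dec (OppositeParity< j w)
oppositeParity<? j w = (parity (suc w) Parity.≟ parity j) ×-dec (w <? j)

-- Deleting the first bit is a bijection from the (n+1)-bit strings counted on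
-- the left onto the n-bit strings of weight < j: the parity constraint
-- determines the deleted bit.
∑[oppositeParity<] : ∀ n j → ∑ {suc n} (λ z → 𝟙 (oppositeParity<? j (weight z))) ≡ #[weight< j ] n
∑[oppositeParity<] n j = begin
  ∑ {suc n} (λ z → 𝟙 (oppositeParity<? j (weight z)))
    ≡⟨ ∑-suc {n} _ ⟩
  ∑ {n} (λ z → 𝟙 (oppositeParity<? j (weight z))) + ∑ {n} (λ z → 𝟙 (oppositeParity<? j (suc (weight z))))
    ≡⟨ ∑-+ {n} _ _ ⟨
  ∑ {n} (λ z → 𝟙 (oppositeParity<? j (weight z)) + 𝟙 (oppositeParity<? j (suc (weight z))))
    ≡⟨ ∑-cong {n} (λ z → bit (weight z)) ⟨
  #[weight< j ] n ∎
  where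
  open ≡-Reasoning
  bit : ∀ w → 𝟙 (w <? j) ≡ 𝟙 (oppositeParity<? j w) + 𝟙 (oppositeParity<? j (suc w))
  bit w = 𝟙-⊎ (oppositeParity<? j w) (oppositeParity<? j (suc w)) (w <? j)
    proj₂ (λ (_ , 1+w<j) → <-trans (n<1+n w) 1+w<j) split
    (λ (odd , _) (even , _) → parity[1+n]≢parity[n] w (trans odd (sym even)))
    where
    split : w < j → OppositeParity< j w ⊎ OppositeParity< j (suc w)
    split w<j with parity (suc w) Parity.≟ parity j
    ... | yes eq = inj₁ (eq , w<j)
    ... | no ≢   = inj₂ (parity-suc-≢ w j ≢ , ≤∧≢⇒< w<j (λ { refl → ≢ refl }))

-- Positions in Sₙ

infix 4 _◁_ _◁?_ _≺_

_◁_ : Vertex n → Vertex n → Set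
z ◁ x = parity (weight z) ≡ parity (weight x) × (weight z < weight x ⊎ weight z ≡ weight x × x <ₗ z)

_<ₗ?_ : (x y : Vertex n) → Dec (x <ₗ y)
_<ₗ?_ = <-decidable Bool._≟_ Bool._<?_

_◁?_ : (z x : Vertex n) → Dec (z ◁ x)
z ◁? x = (parity (weight z) Parity.≟ parity (weight x))
  ×-dec ((weight z <? weight x) ⊎-dec ((weight z ≟ weight x) ×-dec (x <ₗ? z)))

◁-asym : {x y : Vertex n} → x ◁ y → ¬ y ◁ x
◁-asym (_ , inj₁ x<y)        (_ , inj₁ y<x)        = <⇒≯ x<y y<x
◁-asym (_ , inj₁ x<y)        (_ , inj₂ (y≡x , _))  = <⇒≢ x<y (sym y≡x)
◁-asym (_ , inj₂ (x≡y , _))  (_ , inj₁ y<x)        = <⇒≢ y<x (sym x≡y)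
◁-asym (_ , inj₂ (_ , y<x))  (_ , inj₂ (_ , x<y))  = <ₗ-asym sym (resp₂ _) Bool.<-asym x<y y<x

-- The order of the strings in `Sₙ n`, expressed through `◁`: forwards on odd weights, backwards on
-- even ones. In the last two constructors `◁` transfers the given parity to the other string.
data _≺_ {n} (x y : Vertex n) : Set where
  odd-even  : parity (weight x) ≡ 1ℙ → parity (weight y) ≡ 0ℙ → x ≺ y
  odd-odd   : parity (weight y) ≡ 1ℙ → x ◁ y → x ≺ y
  even-even : parity (weight x) ≡ 0ℙ → y ◁ x → x ≺ y

1ℙ≢0ℙ : {p : Parity} → p ≡ 1ℙ → ¬ p ≡ 0ℙ
1ℙ≢0ℙ refl ()

module _ {x : Vertex n} (odd : parity (weight x) ≡ 1ℙ) where

  -- Together with `odd-≺⇒⋪` this evaluates `𝟙 (z ◁? x)` for odd `x`: it is 1 before `x` and 0 after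
  -- it.
  ≺-odd⇒◁ : {z : Vertex n} → z ≺ x → z ◁ x
  ≺-odd⇒◁ (odd-even _ even)          = contradiction even (1ℙ≢0ℙ odd)
  ≺-odd⇒◁ (odd-odd _ z◁x)            = z◁x
  ≺-odd⇒◁ (even-even even (same , _)) = contradiction (trans same even) (1ℙ≢0ℙ odd)

  odd-≺⇒⋪ : {z : Vertex n} → x ≺ z → ¬ z ◁ x
  odd-≺⇒⋪ (odd-even _ even) (same , _) = 1ℙ≢0ℙ (trans same odd) even
  odd-≺⇒⋪ (odd-odd _ x◁z)              = ◁-asym x◁z
  odd-≺⇒⋪ (even-even even _)           = contradiction even (1ℙ≢0ℙ odd)

module _ {x : Vertex n} (even : parity (weight x) ≡ 0ℙ) where

  -- For even `x` the roles are exchanged: with `≺-even⇒⋪`, the indicator is 1 after `x` and 0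
  -- before it.
  even-≺⇒◁ : {z : Vertex n} → x ≺ z → z ◁ x
  even-≺⇒◁ (odd-even odd _)         = contradiction even (1ℙ≢0ℙ odd)
  even-≺⇒◁ (odd-odd odd (same , _)) = contradiction (trans (sym same) even) (1ℙ≢0ℙ odd)
  even-≺⇒◁ (even-even _ z◁x)        = z◁x

  ≺-even⇒⋪ : {z : Vertex n} → z ≺ x → ¬ z ◁ x
  ≺-even⇒⋪ (odd-even odd _) (same , _) = 1ℙ≢0ℙ odd (trans same even)
  ≺-even⇒⋪ (odd-odd odd _)             = contradiction even (1ℙ≢0ℙ odd)
  ≺-even⇒⋪ (even-even _ x◁z)           = ◁-asym x◁z

-- Lets a fact about single entries, such as the common weight of a block or the parity of the
-- listed weights, enter a pairwise comparison.
AllPairs-map-All : {R T : A → A → Set} {Q : A → Set} → (∀ {x y} → Q x → Q y → R x y → T x y) →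
                   ∀ {xs} → All Q xs → AllPairs R xs → AllPairs T xs
AllPairs-map-All f []         []         = []
AllPairs-map-All f (px ∷ pxs) (rx ∷ rxs) =
  All.zipWith (λ (py , r) → f px py r) (pxs , rx) ∷ AllPairs-map-All f pxs rxs

-- Three levels of comparison: odd weights precede even ones; within one parity, blocks are ordered
-- by weight; within one block, the lexicographic order decides.
Sₙ-sorted : ∀ n → AllPairs _≺_ (Sₙ n)
Sₙ-sorted n = AllPairs.++⁺ odds evens
  (All.tabulate λ x∈ → All.tabulate λ y∈ → odd-even (parity-odds x∈) (parity-evens y∈))
  where
  odd-weights : All (λ i → parity i ≡ 1ℙ) (oddWeights↑ n)
  odd-weights = All.map (λ {i} → 2∤⇒parity≡1 i) (All.all-filter (λ i → ¬? (2 ∣? i)) (upTo (suc n)))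

  even-weights : All (λ i → parity i ≡ 0ℙ) (evenWeights↓ n)
  even-weights = All.map (λ {i} → 2∣⇒parity≡0 i) (All.all-filter (2 ∣?_) (downFrom (suc n)))

  weight-R : ∀ i → All (λ x → weight x ≡ i) (R n i)
  weight-R i = All.tabulate (Equivalence.to ∈-R)

  weight-S : ∀ i → All (λ x → weight x ≡ i) (S n i)
  weight-S i = All.tabulate (Equivalence.to ∈-S)

  parity-odds : ∀ {x} → x ∈ concatMap (R n) (oddWeights↑ n) → parity (weight x) ≡ 1ℙ
  parity-odds = All.lookup (All.concat⁺ (All.map⁺ (All.map
    (λ {i} odd → All.map (λ { refl → odd }) (weight-R i)) odd-weights)))

  parity-evens : ∀ {x} → x ∈ concatMap (S n) (evenWeights↓ n) → parity (weight x) ≡ 0ℙ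
  parity-evens = All.lookup (All.concat⁺ (All.map⁺ (All.map
    (λ {i} even → All.map (λ { refl → even }) (weight-S i)) even-weights)))

  odds : AllPairs _≺_ (concatMap (R n) (oddWeights↑ n))
  odds = AllPairs.concat⁺
    (All.map⁺ (All.map (λ {i} odd → AllPairs-map-All
      (λ { refl y≡i y<x → odd-odd (trans (cong parity y≡i) odd)
                                  (cong parity (sym y≡i) , inj₂ (sym y≡i , y<x)) })
      (weight-R i) (R-decreasing n i)) odd-weights))
    -- Strings from different odd blocks: the block of smaller weight comes first.
    (AllPairs.map⁺ (AllPairs-map-All {R = _<_}
      (λ {i} {j} odd-i odd-j i<j → All.map (λ { refl → All.map (λ { refl →
        odd-odd odd-j (trans odd-i (sym odd-j) , inj₁ i<j) }) (weight-R j) }) (weight-R i))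
      odd-weights
      (AllPairs.filter⁺ (λ i → ¬? (2 ∣? i)) (AllPairs.applyUpTo⁺₁ id (suc n) (λ i<j _ → i<j)))))

  evens : AllPairs _≺_ (concatMap (S n) (evenWeights↓ n))
  evens = AllPairs.concat⁺
    (All.map⁺ (All.map (λ {i} even → AllPairs-map-All
      (λ { refl y≡i x<y → even-even even (cong parity y≡i , inj₂ (y≡i , x<y)) })
      (weight-S i) (S-increasing n i)) even-weights))
    -- Even blocks come in decreasing weight, so here the later string is the lighter one.
    (AllPairs.map⁺ (AllPairs-map-All {R = flip _<_}
      (λ {i} {j} even-i even-j j<i → All.map (λ { refl → All.map (λ { refl →
        even-even even-i (trans even-j (sym even-i) , inj₁ j<i) }) (weight-S j) }) (weight-S i))
      even-weights
      (AllPairs.filter⁺ (2 ∣?_) (AllPairs.applyDownFrom⁺₁ id (suc n) (λ j<i _ → j<i)))))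

-- Positions as counts in a sorted list

sum-const : ∀ {g : A → ℕ} {c xs} → All (λ x → g x ≡ c) xs → sum (map g xs) ≡ length xs * c
sum-const []         = refl
sum-const (eq ∷ eqs) = cong₂ _+_ eq (sum-const eqs)

module _ {_<′_ : A → A → Set} {x : A} (g : A → ℕ) (gx≡0 : g x ≡ 0) where

  -- Here `g` is the indicator of the entries before `x`, whose number is the 0-based index of `x`.
  index-counts-before : (∀ {z} → z <′ x → g z ≡ 1) → (∀ {z} → x <′ z → g z ≡ 0) →
    ∀ {xs} → AllPairs _<′_ xs → (x∈ : x ∈ xs) → toℕ (index x∈) ≡ sum (map g xs)
  index-counts-before before after {_ ∷ xs} (x< ∷ _) (here refl) = sym (trans
    (cong₂ _+_ gx≡0 (sum-const (All.map after x<))) (*-zeroʳ (length xs)))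
  index-counts-before before after (y< ∷ xs<) (there x∈) = sym (cong₂ _+_
    (before (All.lookup y< x∈)) (sym (index-counts-before before after xs< x∈)))

  -- Here `g` is the indicator of the entries after `x`; their number and the 1-based position of
  -- `x` add up to the length.
  index-counts-after : (∀ {z} → z <′ x → g z ≡ 0) → (∀ {z} → x <′ z → g z ≡ 1) →
    ∀ {xs} → AllPairs _<′_ xs → (x∈ : x ∈ xs) → suc (toℕ (index x∈)) + sum (map g xs) ≡ length xs
  index-counts-after before after {_ ∷ xs} (x< ∷ _) (here refl) = cong suc (trans
    (cong₂ _+_ gx≡0 (sum-const (All.map after x<))) (*-identityʳ (length xs)))
  index-counts-after before after {y ∷ xs} (y< ∷ xs<) (there x∈) = cong suc (trans
    (cong (λ gy → suc (toℕ (index x∈)) + (gy + sum (map g xs))) (before (All.lookup y< x∈)))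
    (index-counts-after before after xs< x∈))

#◁ : Vertex n → ℕ
#◁ x = ∑ (λ z → 𝟙 (z ◁? x))

-- `Sₙ n` and `vertices n` are permutations of each other, as both list every string without
-- repetition.
∑-Sₙ : (g : Vertex n → ℕ) → sum (map g (Sₙ n)) ≡ ∑ g
∑-Sₙ {n} g = sum-↭ (map⁺ g (∼bag⇒↭ (unique∧set⇒bag (Sₙ-unique n)
  (AllPairs.map <ₗ⇒≢ (vertices-sorted n)) (λ {x} → mk⇔ (λ _ → ∈-vertices x) (λ _ → ∈-Sₙ x)))))

f-odd : (x : Vertex n) → parity (weight x) ≡ 1ℙ → f n x ≡ suc (#◁ x)
f-odd {n} x odd = cong suc (trans
  (index-counts-before (λ z → 𝟙 (z ◁? x)) (𝟙-no (x ◁? x) (λ x◁x → ◁-asym x◁x x◁x))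
    (λ z≺x → 𝟙-yes (_ ◁? x) (≺-odd⇒◁ odd z≺x)) (λ x≺z → 𝟙-no (_ ◁? x) (odd-≺⇒⋪ odd x≺z))
    (Sₙ-sorted n) (∈-Sₙ x))
  (∑-Sₙ (λ z → 𝟙 (z ◁? x))))

-- The strings `z ◁ x` are those after `x`. The additive form avoids truncated subtraction.
f-even : (x : Vertex n) → parity (weight x) ≡ 0ℙ → f n x + #◁ x ≡ 2 ^ n
f-even {n} x even = trans (cong (f n x +_) (sym (∑-Sₙ (λ z → 𝟙 (z ◁? x))))) (trans
  (index-counts-after (λ z → 𝟙 (z ◁? x)) (𝟙-no (x ◁? x) (λ x◁x → ◁-asym x◁x x◁x))
    (λ z≺x → 𝟙-no (_ ◁? x) (≺-even⇒⋪ even z≺x)) (λ x≺z → 𝟙-yes (_ ◁? x) (even-≺⇒◁ even x≺z))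
    (Sₙ-sorted n) (∈-Sₙ x))
  (length-Sₙ n))

-- The prefix 11

-- For `m = n − 3` this is `G(i)`, with `#[weight< j ] m` as `L(j)`.
gain : ℕ → ℕ → ℕ
gain m i = #[weight< suc i ] m + 2 * #[weight< i ] m

-- With `i = weight u`, prefix 00 contributes `L(i+1)`, prefixes 01 and 10 contribute `L(i)` each,
-- and prefix 11 reproduces `#◁ u`.
#◁-11 : ∀ {m} (u : Vertex (suc m)) → #◁ (true ∷ true ∷ u) ≡ #◁ u + gain m (weight u)
#◁-11 {m} u = begin
  #◁ (true ∷ true ∷ u)
    ≡⟨ ∑-suc {2 + m} _ ⟩
  ∑ {2 + m} (λ z → g (false ∷ z)) + ∑ {2 + m} (λ z → g (true ∷ z))
    ≡⟨ cong₂ _+_ (∑-suc {suc m} _) (∑-suc {suc m} _) ⟩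
  ∑ {suc m} (λ z → g (false ∷ false ∷ z)) + ∑ {suc m} (λ z → g (false ∷ true ∷ z)) +
  (∑ {suc m} (λ z → g (true ∷ false ∷ z)) + ∑ {suc m} (λ z → g (true ∷ true ∷ z)))
    ≡⟨ cong₂ _+_ (cong₂ _+_ (count (suc i) 00-part) (count i 01-part)) (cong₂ _+_ (count i 10-part) (∑-cong {suc m} 11-part)) ⟩
  #[weight< suc i ] m + #[weight< i ] m + (#[weight< i ] m + #◁ u)
    ≡⟨ rearrange (#[weight< suc i ] m) (#[weight< i ] m) (#◁ u) ⟩
  #◁ u + gain m i ∎
  where
  open ≡-Reasoning
  i = weight u

  g : Vertex (3 + m) → ℕ
  g z = 𝟙 (z ◁? (true ∷ true ∷ u))

  rearrange : ∀ a b c → a + b + (b + c) ≡ c + (a + 2 * b)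
  rearrange = solve-∀

  count : ∀ {h} j → (∀ z → h z ≡ 𝟙 (oppositeParity<? j (weight z))) → ∑ {suc m} h ≡ #[weight< j ] m
  count j eq = trans (∑-cong {suc m} eq) (∑[oppositeParity<] m j)

  00-part : ∀ z → g (false ∷ false ∷ z) ≡ 𝟙 (oppositeParity<? (suc i) (weight z))
  00-part z = 𝟙-cong ((false ∷ false ∷ z) ◁? (true ∷ true ∷ u)) (oppositeParity<? (suc i) (weight z))
    -- A weight below `2 + i` with the parity of `i` is at most `i`. Equal weights give nothing,
    -- since a string beginning with 0 is not lexicographically larger than one beginning with 1.
    (λ { (eq , inj₁ w<2+i) → parity-suc-cong (weight z) i eq , s≤s (parity≡⇒≤ eq w<2+i)
       ; (_ , inj₂ (_ , this () _)) ; (_ , inj₂ (_ , next () _)) })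
    (λ (eq , w<1+i) → parity-suc-cong (suc (weight z)) (suc i) eq , inj₁ (m<n⇒m<1+n w<1+i))

  01-part : ∀ z → g (false ∷ true ∷ z) ≡ 𝟙 (oppositeParity<? i (weight z))
  01-part z = 𝟙-cong ((false ∷ true ∷ z) ◁? (true ∷ true ∷ u)) (oppositeParity<? i (weight z))
    -- The leading 1 counts towards the weight, so the same bound now reads `suc (weight z) ≤ i`.
    (λ { (eq , inj₁ w<2+i) → eq , parity≡⇒≤ eq w<2+i
       ; (_ , inj₂ (_ , this () _)) ; (_ , inj₂ (_ , next () _)) })
    (λ (eq , w<i) → eq , inj₁ (s≤s (m<n⇒m<1+n w<i)))

  10-part : ∀ z → g (true ∷ false ∷ z) ≡ 𝟙 (oppositeParity<? i (weight z))
  10-part z = 𝟙-cong ((true ∷ false ∷ z) ◁? (true ∷ true ∷ u)) (oppositeParity<? i (weight z))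
    (λ { (eq , inj₁ w<2+i) → eq , parity≡⇒≤ eq w<2+i
       ; (_ , inj₂ (_ , this () _)) ; (_ , inj₂ (_ , next _ (this () _))) ; (_ , inj₂ (_ , next _ (next () _))) })
    (λ (eq , w<i) → eq , inj₁ (s≤s (m<n⇒m<1+n w<i)))

  11-part : ∀ z → g (true ∷ true ∷ z) ≡ 𝟙 (z ◁? u)
  11-part z = 𝟙-cong ((true ∷ true ∷ z) ◁? (true ∷ true ∷ u)) (z ◁? u)
    (λ { (eq , inj₁ w<i) → eq , inj₁ (s≤s⁻¹ (s≤s⁻¹ w<i))
       ; (_ , inj₂ (_ , this () _)) ; (_ , inj₂ (_ , next _ (this () _)))
       ; (eq , inj₂ (w≡i , next _ (next _ u<z))) → eq , inj₂ (suc-injective (suc-injective w≡i) , u<z) })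
    (λ { (eq , inj₁ w<i) → eq , inj₁ (s≤s (s≤s w<i))
       ; (eq , inj₂ (w≡i , u<z)) → eq , inj₂ (cong (2 +_) w≡i , next refl (next refl u<z)) })

module _ {m : ℕ} where

  f-11-odd : (u : Vertex (suc m)) → parity (weight u) ≡ 1ℙ →
             f (3 + m) (true ∷ true ∷ u) ≡ f (suc m) u + gain m (weight u)
  f-11-odd u odd = begin
    f (3 + m) (true ∷ true ∷ u)     ≡⟨ f-odd (true ∷ true ∷ u) odd ⟩
    suc (#◁ (true ∷ true ∷ u))      ≡⟨ cong suc (#◁-11 u) ⟩
    suc (#◁ u) + gain m (weight u)  ≡⟨ cong (_+ gain m (weight u)) (f-odd u odd) ⟨
    f (suc m) u + gain m (weight u) ∎
    where open ≡-Reasoning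

  -- The gain lowers an even label, so it stands on the left; `3 * 2 ^ suc m` is the difference of
  -- the two cube sizes.
  f-11-even : (v : Vertex (suc m)) → parity (weight v) ≡ 0ℙ →
              f (3 + m) (true ∷ true ∷ v) + gain m (weight v) ≡ f (suc m) v + 3 * 2 ^ suc m
  f-11-even v even = +-cancelʳ-≡ (#◁ v) _ _ (begin
    F + G + #◁ v                  ≡⟨ shuffle₁ F G (#◁ v) ⟩
    F + (#◁ v + G)                ≡⟨ cong (F +_) (#◁-11 v) ⟨
    F + #◁ (true ∷ true ∷ v)      ≡⟨ f-even (true ∷ true ∷ v) even ⟩
    2 ^ (3 + m)                   ≡⟨ shuffle₂ (2 ^ suc m) ⟩
    2 ^ suc m + 3 * 2 ^ suc m     ≡⟨ cong (_+ 3 * 2 ^ suc m) (f-even v even) ⟨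
    f (suc m) v + #◁ v + 3 * 2 ^ suc m ≡⟨ shuffle₃ (f (suc m) v) (#◁ v) (3 * 2 ^ suc m) ⟩
    f (suc m) v + 3 * 2 ^ suc m + #◁ v ∎)
    where
    open ≡-Reasoning
    F = f (3 + m) (true ∷ true ∷ v)
    G = gain m (weight v)
    shuffle₁ : ∀ a b c → a + b + c ≡ a + (c + b)
    shuffle₁ = solve-∀
    shuffle₂ : ∀ a → 2 * (2 * a) ≡ a + 3 * a
    shuffle₂ = solve-∀
    shuffle₃ : ∀ a b c → a + b + c ≡ a + c + b
    shuffle₃ = solve-∀

  -- The first summand of `gain` grows by `m C suc k` and the doubled one by `2 * (m C k)`; Pascal's
  -- rule merges one `m C k` with `m C suc k`.
  gain-suc : ∀ k → gain m (suc k) ≡ gain m k + (m C k + suc m C suc k)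
  gain-suc k = begin
    gain m (suc k)                                        ≡⟨ cong₂ (λ a b → a + 2 * b) (#[weight<1+j] m (suc k)) (#[weight<1+j] m k) ⟩
    #[weight< suc k ] m + m C suc k + 2 * (#[weight< k ] m + m C k) ≡⟨ shuffle (#[weight< suc k ] m) (#[weight< k ] m) (m C k) (m C suc k) ⟩
    gain m k + (m C k + (m C k + m C suc k))              ≡⟨ cong (λ c → gain m k + (m C k + c)) (nCk+nC[k+1]≡[n+1]C[k+1] m k) ⟩
    gain m k + (m C k + suc m C suc k)                    ∎
    where
    open ≡-Reasoning
    shuffle : ∀ a b c d → a + d + 2 * (b + c) ≡ a + 2 * b + (c + (c + d))
    shuffle = solve-∀

  -- If `i` is the larger weight, both coefficients in `gain-suc` are bounded by central ones. If
  -- `k` is the larger, `gain m i ≤ gain m k` already.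
  gain-≤ : ∀ {i k} → i ≡ suc k ⊎ k ≡ suc i → gain m i ≤ gain m k + (m C ⌈ m /2⌉ + suc m C ⌈ suc m /2⌉)
  gain-≤ {k = k} (inj₁ refl) = ≤-trans (≤-reflexive (gain-suc k))
    (+-monoʳ-≤ (gain m k) (+-mono-≤ (nCk≤nC⌈n/2⌉ m k) (nCk≤nC⌈n/2⌉ (suc m) (suc k))))
  gain-≤ {i = i} (inj₂ refl) = ≤-trans (≤-trans (m≤m+n (gain m i) _) (≤-reflexive (sym (gain-suc i)))) (m≤m+n _ _)

-- Edges of the cube

hamming≡0⇒≡ : (x y : Vertex n) → hamming x y ≡ 0 → x ≡ y
hamming≡0⇒≡ []          []          _  = refl
hamming≡0⇒≡ (false ∷ x) (false ∷ y) eq = cong (false ∷_) (hamming≡0⇒≡ x y eq)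
hamming≡0⇒≡ (true ∷ x)  (true ∷ y)  eq = cong (true ∷_) (hamming≡0⇒≡ x y eq)

adjacent⇒weight : (x y : Vertex n) → Adjacent x y → weight x ≡ suc (weight y) ⊎ weight y ≡ suc (weight x)
adjacent⇒weight []          []          ()
adjacent⇒weight (false ∷ x) (false ∷ y) adj = adjacent⇒weight x y adj
adjacent⇒weight (false ∷ x) (true ∷ y)  adj = inj₂ (cong (suc ∘ weight) (sym (hamming≡0⇒≡ x y (suc-injective adj))))
adjacent⇒weight (true ∷ x)  (false ∷ y) adj = inj₁ (cong (suc ∘ weight) (hamming≡0⇒≡ x y (suc-injective adj)))
adjacent⇒weight (true ∷ x)  (true ∷ y)  adj with adjacent⇒weight x y adj
... | inj₁ eq = inj₁ (cong suc eq)
... | inj₂ eq = inj₂ (cong suc eq)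

adjacent⇒≤str : (g : Vertex n → ℕ) (x y : Vertex n) → Adjacent x y → g x + g y ≤ str g
adjacent⇒≤str {n} g x y adj = v≤max⁺ 0 _ (inj₂ (lose
  (∈-map⁺ (λ (u , v) → g u + g v)
    (∈-filter⁺ (λ (u , v) → hamming u v ≟ 1) (∈-cartesianProduct⁺ (∈-vertices x) (∈-vertices y)) adj))
  ≤-refl))

-- Label sums of edges with prefix 11

f-11-edge : ∀ {m} (u v : Vertex (suc m)) → parity (weight u) ≡ 1ℙ → parity (weight v) ≡ 0ℙ →
  weight u ≡ suc (weight v) ⊎ weight v ≡ suc (weight u) →
  f (3 + m) (true ∷ true ∷ u) + f (3 + m) (true ∷ true ∷ v) ≤
  f (suc m) u + f (suc m) v + 3 * 2 ^ suc m + (m C ⌈ m /2⌉) + (suc m C ⌈ suc m /2⌉)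
-- Adding the gain of the even endpoint to both sides brings its label into the form of `f-11-even`.
f-11-edge {m} u v odd even w = +-cancelʳ-≤ (gain m (weight v)) _ _ (begin
  f (3 + m) (true ∷ true ∷ u) + f (3 + m) (true ∷ true ∷ v) + gain m (weight v)
    ≡⟨ +-assoc (f (3 + m) (true ∷ true ∷ u)) _ _ ⟩
  f (3 + m) (true ∷ true ∷ u) + (f (3 + m) (true ∷ true ∷ v) + gain m (weight v))
    ≡⟨ cong₂ _+_ (f-11-odd u odd) (f-11-even v even) ⟩
  f (suc m) u + gain m (weight u) + (f (suc m) v + 3 * 2 ^ suc m)
    ≤⟨ +-monoˡ-≤ _ (+-monoʳ-≤ (f (suc m) u) (gain-≤ {m} w)) ⟩
  f (suc m) u + (gain m (weight v) + (m C ⌈ m /2⌉ + suc m C ⌈ suc m /2⌉)) + (f (suc m) v + 3 * 2 ^ suc m)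
    ≡⟨ shuffle (f (suc m) u) (gain m (weight v)) (m C ⌈ m /2⌉) (suc m C ⌈ suc m /2⌉) (f (suc m) v) (3 * 2 ^ suc m) ⟩
  f (suc m) u + f (suc m) v + 3 * 2 ^ suc m + (m C ⌈ m /2⌉) + (suc m C ⌈ suc m /2⌉) + gain m (weight v) ∎)
  where
  open ≤-Reasoning
  shuffle : ∀ a b c d e p → a + (b + (c + d)) + (e + p) ≡ a + e + p + c + d + b
  shuffle = solve-∀

f-11-adjacent : ∀ {m} (u v : Vertex (suc m)) → Adjacent u v →
  f (3 + m) (true ∷ true ∷ u) + f (3 + m) (true ∷ true ∷ v) ≤
  f (suc m) u + f (suc m) v + 3 * 2 ^ suc m + (m C ⌈ m /2⌉) + (suc m C ⌈ suc m /2⌉)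
f-11-adjacent {m} u v adj with adjacent⇒weight u v adj | parity (weight u) in pu | parity (weight v) in pv
... | w | 1ℙ | 0ℙ = f-11-edge u v pu pv w
-- Here `v` is the odd endpoint, so the endpoints exchange roles.
... | w | 0ℙ | 1ℙ = subst₂ _≤_ (+-comm (f (3 + m) (true ∷ true ∷ v)) _)
  (cong (λ s → s + 3 * 2 ^ suc m + (m C ⌈ m /2⌉) + (suc m C ⌈ suc m /2⌉)) (+-comm (f (suc m) v) (f (suc m) u)))
  (f-11-edge v u pv pu (swap w))
-- Weights that differ by one cannot have equal parity.
... | inj₁ eq | 0ℙ | 0ℙ = contradiction (trans (cong parity (sym eq)) (trans pu (sym pv))) (parity[1+n]≢parity[n] (weight v))
... | inj₂ eq | 0ℙ | 0ℙ = contradiction (trans (cong parity (sym eq)) (trans pv (sym pu))) (parity[1+n]≢parity[n] (weight u))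
... | inj₁ eq | 1ℙ | 1ℙ = contradiction (trans (cong parity (sym eq)) (trans pu (sym pv))) (parity[1+n]≢parity[n] (weight v))
... | inj₂ eq | 1ℙ | 1ℙ = contradiction (trans (cong parity (sym eq)) (trans pv (sym pu))) (parity[1+n]≢parity[n] (weight u))

theorem2p6 : (n : ℕ) → 5 ≤ n → 2 ∣ n → (x y : Vertex n) → Adjacent x y →
    f n x + f n y ≡ str (f n) →
    BeginsWith (true ∷ true ∷ []) x → BeginsWith (true ∷ true ∷ []) y →
    str (f n) ≤ str (f (n ∸ 2)) + 3 * 2 ^ (n ∸ 2) + ((n ∸ 3) C ⌈ n ∸ 3 /2⌉) + ((n ∸ 2) C ⌈ n ∸ 2 /2⌉)
theorem2p6 (suc (suc zero)) (s≤s (s≤s ())) _ _ _ _ _ _ _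
theorem2p6 (suc (suc (suc m))) _ _ (true ∷ true ∷ u) (true ∷ true ∷ v) adj fx+fy≡str
           (refl Prefix.∷ refl Prefix.∷ _) (refl Prefix.∷ refl Prefix.∷ _) = begin
  str (f (3 + m))
    ≡⟨ fx+fy≡str ⟨
  f (3 + m) (true ∷ true ∷ u) + f (3 + m) (true ∷ true ∷ v)
    -- Equal leading bits add nothing to the Hamming distance, so `adj` is by computation also a
    -- proof that `u` and `v` are adjacent.
    ≤⟨ f-11-adjacent u v adj ⟩
  f (suc m) u + f (suc m) v + 3 * 2 ^ suc m + (m C ⌈ m /2⌉) + (suc m C ⌈ suc m /2⌉)
    ≤⟨ +-monoˡ-≤ _ (+-monoˡ-≤ _ (+-monoˡ-≤ _ (adjacent⇒≤str (f (suc m)) u v adj))) ⟩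
  str (f (suc m)) + 3 * 2 ^ suc m + (m C ⌈ m /2⌉) + (suc m C ⌈ suc m /2⌉) ∎
  where open ≤-Reasoning
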